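{- Let $M,N,S$ be positive integers with $M>N$, and let $Q$ denote the I/O complexity (minimum number of Load moves over all complete red-white pebble games with $S$ red pebbles) of the CDAG of the Householder QR program (A2V part) below applied to an $M\times N$ matrix $A$. Then $$\frac{(3M-N)N^2(M-N)^2}{24(MS+(M-N)^2)} \leq Q .$$
   Context: Program (Householder QR, A2V part, corresponding to LAPACK GEQR2), with input $M\times N$ array $A$, array $tau$ of length $N$, scalars $norma2$, $norma$: for k = 0,...,N-1: norma2 = 0.0 for i = k+1,...,M-1: norma2 += A[i][k]*A[i][k] norma = sqrt(A[k][k]*A[k][k] + norma2) A[k][k] = (A[k][k] > 0) ? (A[k][k] + norma) : (A[k][k] - norma) tau[k] = 2.0 / (1.0 + norma2 / (A[k][k]*A[k][k])) for i = k+1,...,M-1: A[i][k] /= A[k][k] A[k][k] = (A[k][k] > 0) ? (-norma) : (norma) for j = k+1,...,N-1: tau[j] = A[k][j] for i = k+1,...,M-1: tau[j] += A[i][k]*A[i][j] tau[j] = tau[k]*tau[j] A[k][j] = A[k][j] - tau[j] for i = k+1,...,M-1: A[i][j] = A[i][j] - A[i][k]*tau[j] CDAG of a program: a directed acyclic graph whose nodes are the input values (initial values of array entries read before being written) and the statement instances (each execution of an assignment statement, including compound assignments), with an edge $u\to v$ whenever the instance $v$ reads a value produced by $u$ (flow dependence). Input nodes have no incoming edges. Red-white pebble game with $S$ red pebbles on a CDAG: initially only the input nodes carry white pebbles and there are no red pebbles. Allowed moves: (Spill) remove a red pebble from a node; (Compute) if a node has no white pebble and all its predecessors carry red pebbles,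 place a white and a red pebble on it; (Load) place a red pebble on a node carrying a white pebble. At no time may more than $S$ red pebbles be on the graph. The game is complete when every node carries a white pebble. The I/O complexity $Q$ is the minimum, over all complete games, of the number of Load moves. -}

module Defs where

open import Data.Nat using (ℕ; zero; suc; _+_; _*_; _∸_; _≡ᵇ_)
open import Data.Bool using (Bool; true; false; _∧_; if_then_else_)
open import Data.List using (List; []; _∷_; _++_; map; concatMap; upTo; length; filterᵇ)
open import Data.Bool.ListAction using (any)
open import Data.List.Membership.Propositional using (_∈_)
open import Data.List.Relation.Unary.All using (All)
open import Relation.Binary.PropositionalEquality using (_≡_)

data Loc : Set where
  A      : ℕ → ℕ → Loc
  tau    : ℕ → Loc
  norma2 : Loc
  norma  : Loc

_==L_ : Loc → Loc → Bool
A i j  ==L A i' j' = (i ≡ᵇ i') ∧ (j ≡ᵇ j')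
tau j  ==L tau j'  = j ≡ᵇ j'
norma2 ==L norma2  = true
norma  ==L norma   = true
_      ==L _       = false

-- A statement instance: the location it writes and the list of
-- locations it reads (including the target for compound assignments
-- and the locations read by the conditions of ?: expressions).
record Instr : Set where
  constructor _←_
  field
    write : Loc
    reads : List Loc
open Instr public

range : ℕ → ℕ → List ℕ
range a b = map (a +_) (upTo (b ∸ a))

iterJ : ℕ → ℕ → ℕ → ℕ → List Instr
iterJ M N k j =
     (tau j ← (A k j ∷ []))
  ∷  map (λ i → tau j ← (tau j ∷ A i k ∷ A i j ∷ [])) (range (suc k) M)
  ++ (tau j ← (tau k ∷ tau j ∷ []))
  ∷  (A k j ← (A k j ∷ tau j ∷ []))
  ∷  map (λ i → A i j ← (A i j ∷ A i k ∷ tau j ∷ [])) (range (suc k) M)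

iterK : ℕ → ℕ → ℕ → List Instr
iterK M N k =
     (norma2 ← [])
  ∷  map (λ i → norma2 ← (norma2 ∷ A i k ∷ A i k ∷ [])) (range (suc k) M)
  ++ (norma ← (A k k ∷ A k k ∷ norma2 ∷ []))
  ∷  (A k k ← (A k k ∷ A k k ∷ norma ∷ A k k ∷ norma ∷ []))
  ∷  (tau k ← (norma2 ∷ A k k ∷ A k k ∷ []))
  ∷  map (λ i → A i k ← (A i k ∷ A k k ∷ [])) (range (suc k) M)
  ++ (A k k ← (A k k ∷ norma ∷ norma ∷ []))
  ∷  concatMap (iterJ M N k) (range (suc k) N)

program : ℕ → ℕ → List Instr
program M N = concatMap (iterK M N) (upTo N)

allLocs : ℕ → ℕ → List Loc
allLocs M N =
  concatMap (λ i → map (A i) (upTo N)) (upTo M)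
  ++ map tau (upTo N) ++ norma2 ∷ norma ∷ []

-- Nodes: input values (initial value of a location) and statement
-- instances (identified by their position in the execution trace).
data Node : Set where
  inp : Loc → Node
  ins : ℕ → Node

_==N_ : Node → Node → Bool
inp l ==N inp l' = l ==L l'
ins t ==N ins t' = t ≡ᵇ t'
_     ==N _      = false

-- Predecessor lists of the instances: each read location is mapped to
-- the node that last wrote it (an input node if not yet written).
buildPreds : ℕ → (Loc → Node) → List Instr → List (List Node)
buildPreds t lw []       = []
buildPreds t lw (ι ∷ is) =
  map lw (reads ι) ∷
  buildPreds (suc t) (λ l → if l ==L write ι then ins t else lw l) is

predLists : ℕ → ℕ → List (List Node)
predLists M N = buildPreds 0 inp (program M N)

nth : {X : Set} → X → List X → ℕ → X
nth d []       _       = d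
nth d (x ∷ xs) zero    = x
nth d (x ∷ xs) (suc n) = nth d xs n

preds : ℕ → ℕ → Node → List Node
preds M N (inp l) = []
preds M N (ins t) = nth [] (predLists M N) t

-- An input location is a node iff its initial value is read.
readAsInput : ℕ → ℕ → Loc → Bool
readAsInput M N l = any (any (λ v → v ==N inp l)) (predLists M N)

vertices : ℕ → ℕ → List Node
vertices M N =
  map inp (filterᵇ (readAsInput M N) (allLocs M N))
  ++ map ins (upTo (length (program M N)))

record Config : Set where
  constructor cfg
  field
    red   : Node → Bool
    white : Node → Bool
open Config public

set : (Node → Bool) → Node → Bool → Node → Bool
set f v b u = if u ==N v then b else f u

initial : Config
initial = cfg (λ _ → false) (λ { (inp _) → true ; (ins _) → false })

redCount : ℕ → ℕ → Config → ℕ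
redCount M N c = length (filterᵇ (red c) (vertices M N))

data Move : Set where
  spill compute load : Node → Move

data Step (M N : ℕ) : Config → Move → Config → Set where
  spill   : ∀ {c v} → v ∈ vertices M N → red c v ≡ true →
            Step M N c (spill v) (cfg (set (red c) v false) (white c))
  compute : ∀ {c v} → v ∈ vertices M N → white c v ≡ false →
            All (λ u → red c u ≡ true) (preds M N v) →
            Step M N c (compute v) (cfg (set (red c) v true) (set (white c) v true))
  load    : ∀ {c v} → v ∈ vertices M N → white c v ≡ true →
            Step M N c (load v) (cfg (set (red c) v true) (white c))

data Game (M N S : ℕ) : Config → List Move → Config → Set where
  done : ∀ {c} → Game M N S c [] c
  step : ∀ {c c' c'' m ms} → Step M N c m c' →
         redCount M N c' Data.Nat.≤ S →
         Game M N S c' ms c'' → Game M N S c (m ∷ ms) c''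

Complete : ℕ → ℕ → Config → Set
Complete M N c = ∀ {v} → v ∈ vertices M N → white c v ≡ true

isLoad : Move → Bool
isLoad (load _) = true
isLoad _        = false

loads : List Move → ℕ
loads ms = length (filterᵇ isLoad ms)

module Submission where

-- Let w = M - N, D = M S + w², and let the updates be the instances A[i][j] -= A[i][k] tau[j].
-- Cut a complete game into segments of 3S loads. A node fresh in a segment (computed during it)
-- has each of its predecessors fresh or held, i.e. red at the start or loaded; there are at most
-- K = 4S held nodes. Following the versions of one entry of A backwards, each entry read by a
-- fresh update owns a held node. The first and the last fresh update of every entry account for
-- at most 2K updates. Any other one, at step k of column j say, lies between two fresh updates
-- of the same entry, and then the last w rows of that step are fresh as well (the hourglass), so
-- that columns k and j both own at least w held nodes. There are at most (K/w)²/2 such pairs k <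
-- j, each with at most M updates. Hence w² times the number of fresh updates is at most 8 S D.
-- Summing over the segments gives 3 w² #updates ≤ 8 (#loads + 3S) D. The term 3S is absorbed
-- using #loads ≥ M N, which alone proves the theorem unless S is small compared to M N.

open import Defs
open import Data.Bool using (Bool; true; false; _∧_; not; T; if_then_else_)
import Data.Bool.Properties as Bool
open import Data.Empty using (⊥-elim)
open import Data.List using (List; []; _∷_; _++_; map; concatMap; upTo; applyUpTo; length; filterᵇ)
open import Data.List.Membership.Propositional using (_∈_)
open import Data.List.Membership.Propositional.Properties
  using (∈-map⁺; ∈-++⁺ˡ; ∈-++⁺ʳ; ∈-filter⁺; ∈-upTo⁺)
open import Data.List.Properties using (length-++; ++-assoc; map-upTo; filter-none)
open import Data.List.Relation.Unary.All as All using (All; []; _∷_)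
import Data.List.Relation.Unary.All.Properties as All
open import Data.List.Relation.Unary.Any using (here; there)
open import Data.Nat
open import Data.Nat.Induction using (<-rec)
open import Data.Nat.Properties
open import Data.Nat.Tactic.RingSolver using (solve-∀)
open import Data.Product using (∃; _×_; _,_; proj₁; proj₂)
open import Data.Sum using (_⊎_; inj₁; inj₂)
open import Function using (_∘_; id; Equivalence)
open import Relation.Binary.Definitions using (tri<; tri≈; tri>)
open import Relation.Binary.PropositionalEquality
open import Relation.Nullary using (yes; no)

-- Finite sums and counting with indicators

∑ : ℕ → (ℕ → ℕ) → ℕ
∑ zero    f = 0
∑ (suc n) f = ∑ n f + f n

𝟙 : Bool → ℕ
𝟙 true  = 1
𝟙 false = 0

∑-mono : ∀ n {f g} → (∀ i → i < n → f i ≤ g i) → ∑ n f ≤ ∑ n g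
∑-mono zero    h = z≤n
∑-mono (suc n) h = +-mono-≤ (∑-mono n λ i i<n → h i (m<n⇒m<1+n i<n)) (h n ≤-refl)

∑-cong : ∀ n {f g} → (∀ i → i < n → f i ≡ g i) → ∑ n f ≡ ∑ n g
∑-cong n h = ≤-antisym (∑-mono n λ i i<n → ≤-reflexive (h i i<n))
                       (∑-mono n λ i i<n → ≤-reflexive (sym (h i i<n)))

interchange : ∀ a b c d → (a + b) + (c + d) ≡ (a + c) + (b + d)
interchange = solve-∀

∑-+ : ∀ n f g → ∑ n (λ i → f i + g i) ≡ ∑ n f + ∑ n g
∑-+ zero    f g = refl
∑-+ (suc n) f g =
  trans (cong (_+ (f n + g n)) (∑-+ n f g)) (interchange (∑ n f) (∑ n g) (f n) (g n))

∑-*ˡ : ∀ n c f → ∑ n (λ i → c * f i) ≡ c * ∑ n f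
∑-*ˡ zero    c f = sym (*-zeroʳ c)
∑-*ˡ (suc n) c f = trans (cong (_+ c * f n) (∑-*ˡ n c f)) (sym (*-distribˡ-+ c (∑ n f) (f n)))

∑-const : ∀ n c → ∑ n (λ _ → c) ≡ n * c
∑-const zero    c = refl
∑-const (suc n) c = trans (cong (_+ c) (∑-const n c)) (+-comm (n * c) c)

∑-zero : ∀ n → ∑ n (λ _ → 0) ≡ 0
∑-zero n = trans (∑-const n 0) (*-zeroʳ n)

∑-swap : ∀ m n (f : ℕ → ℕ → ℕ) → ∑ m (λ i → ∑ n (f i)) ≡ ∑ n (λ j → ∑ m (λ i → f i j))
∑-swap zero    n f = sym (∑-zero n)
∑-swap (suc m) n f =
  trans (cong (_+ ∑ n (f m)) (∑-swap m n f)) (sym (∑-+ n (λ j → ∑ m (λ i → f i j)) (f m)))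

∑-single : ∀ n a b {f} → (∀ i → i ≢ a → f i ≡ 0) → f a ≤ b → ∑ n f ≤ b
∑-single zero    a b h fa≤b = z≤n
∑-single (suc n) a b {f} h fa≤b with n ≟ a
... | no n≢a   = subst (_≤ b) (sym (trans (cong (∑ n f +_) (h n n≢a)) (+-identityʳ _)))
                   (∑-single n a b h fa≤b)
... | yes refl = subst (_≤ b) (sym (cong (_+ f n) below)) fa≤b
  where
  below : ∑ n f ≡ 0
  below = trans (∑-cong n λ i i<n → h i (<⇒≢ i<n)) (∑-zero n)

∑-prefix : ∀ {m n} f → m ≤ n → ∑ m f ≤ ∑ n f
∑-prefix {n = zero}  f z≤n = z≤n
∑-prefix {n = suc n} f m≤1+n with m≤n⇒m<n∨m≡n m≤1+n
... | inj₁ (s≤s m≤n) = ≤-trans (∑-prefix f m≤n) (m≤m+n _ _)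
... | inj₂ refl      = ≤-refl

∑-above : ∀ m n c f → (∀ i → m ≤ i → i < m + n → c ≤ f i) → n * c ≤ ∑ (m + n) f
∑-above m zero    c f h = z≤n
∑-above m (suc n) c f h rewrite +-suc m n | +-comm c (n * c) =
  +-mono-≤ (∑-above m n c f λ i m≤i i<m+n → h i m≤i (m<n⇒m<1+n i<m+n)) (h (m + n) (m≤m+n m n) ≤-refl)

-- Exchanging the two indices turns the sum over `k < j` into the one over `j < k`, and together
-- these cover each ordered pair at most once. The factor 1/2 in the count of column pairs comes
-- from here.
∑-pairs : ∀ n d → 2 * ∑ n (λ j → ∑ n (λ k → 𝟙 (k <ᵇ j) * (d k * d j))) ≤ ∑ n d * ∑ n d
∑-pairs n d = begin
  2 * ∑ n (λ j → ∑ n (λ k → 𝟙 (k <ᵇ j) * (d k * d j)))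
    ≡⟨ cong (∑ n (λ j → ∑ n (up j)) +_) (+-identityʳ _) ⟩
  ∑ n (λ j → ∑ n (up j)) + ∑ n (λ j → ∑ n (up j))
    ≡⟨ cong (∑ n (λ j → ∑ n (up j)) +_) (∑-swap n n up) ⟩
  ∑ n (λ j → ∑ n (up j)) + ∑ n (λ j → ∑ n (λ k → up k j))
    ≡⟨ ∑-+ n _ _ ⟨
  ∑ n (λ j → ∑ n (up j) + ∑ n (λ k → up k j))
    ≡⟨ ∑-cong n (λ j _ → ∑-+ n (up j) (λ k → up k j)) ⟨
  ∑ n (λ j → ∑ n (λ k → up j k + up k j))
    ≤⟨ ∑-mono n (λ j _ → ∑-mono n λ k _ → both j k) ⟩
  ∑ n (λ j → ∑ n (λ k → d j * d k))
    ≡⟨ ∑-cong n (λ j _ → ∑-*ˡ n (d j) d) ⟩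
  ∑ n (λ j → d j * ∑ n d)
    ≡⟨ ∑-cong n (λ j _ → *-comm (d j) _) ⟩
  ∑ n (λ j → ∑ n d * d j)
    ≡⟨ ∑-*ˡ n (∑ n d) d ⟩
  ∑ n d * ∑ n d ∎
  where
  open ≤-Reasoning
  up : ℕ → ℕ → ℕ
  up j k = 𝟙 (k <ᵇ j) * (d k * d j)
  exclusive : ∀ j k → 𝟙 (k <ᵇ j) + 𝟙 (j <ᵇ k) ≤ 1
  exclusive zero    zero    = z≤n
  exclusive zero    (suc k) = ≤-refl
  exclusive (suc j) zero    = ≤-refl
  exclusive (suc j) (suc k) = exclusive j k
  factor : ∀ a b x y → a * (x * y) + b * (y * x) ≡ (a + b) * (y * x)
  factor = solve-∀
  both : ∀ j k → up j k + up k j ≤ d j * d k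
  both j k = begin
    up j k + up k j                              ≡⟨ factor (𝟙 (k <ᵇ j)) (𝟙 (j <ᵇ k)) (d k) (d j) ⟩
    (𝟙 (k <ᵇ j) + 𝟙 (j <ᵇ k)) * (d j * d k)      ≤⟨ *-monoˡ-≤ (d j * d k) (exclusive j k) ⟩
    1 * (d j * d k)                              ≡⟨ *-identityˡ _ ⟩
    d j * d k                                    ∎

𝟙≤1 : ∀ b → 𝟙 b ≤ 1
𝟙≤1 true  = ≤-refl
𝟙≤1 false = z≤n

𝟙≤ : ∀ b {n} → (b ≡ true → 1 ≤ n) → 𝟙 b ≤ n
𝟙≤ true  h = h refl
𝟙≤ false h = z≤n

-- One-sided half of `∑-interior`, by induction from the top: an element with an earlier one below
-- it is paid by `g`; otherwise it is the first and is paid by `κ`.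
∑-non-first : ∀ n (p : ℕ → Bool) {κ} (g : ℕ → ℕ) →
  (∀ k → k < n → p k ≡ true → 1 ≤ κ) →
  (∀ k₁ k → k₁ < k → k < n → p k₁ ≡ true → p k ≡ true → 1 ≤ g k) →
  ∑ n (λ k → 𝟙 (p k)) ≤ κ + ∑ n g
∑-non-first zero    p g one mid = z≤n
∑-non-first (suc n) p {κ} g one mid with anyUpTo? (λ k → p k Bool.≟ true) n
... | no none = begin
  ∑ n (λ k → 𝟙 (p k)) + 𝟙 (p n)
    ≤⟨ +-mono-≤ (∑-mono n λ k k<n → 𝟙≤ (p k) λ pk → ⊥-elim (none (k , k<n , pk)))
                (𝟙≤ (p n) (one n ≤-refl)) ⟩
  ∑ n g + κ          ≡⟨ +-comm _ κ ⟩
  κ + ∑ n g          ≤⟨ +-monoʳ-≤ κ (m≤m+n _ _) ⟩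
  κ + ∑ (suc n) g    ∎
  where open ≤-Reasoning
... | yes (k₁ , k₁<n , pk₁) = begin
  ∑ n (λ k → 𝟙 (p k)) + 𝟙 (p n)
    ≤⟨ +-mono-≤ (∑-non-first n p g (λ k k<n → one k (m<n⇒m<1+n k<n))
                                   (λ k₀ k k₀<k k<n → mid k₀ k k₀<k (m<n⇒m<1+n k<n)))
                (𝟙≤ (p n) (mid k₁ n k₁<n ≤-refl pk₁)) ⟩
  κ + ∑ n g + g n    ≡⟨ +-assoc κ _ _ ⟩
  κ + ∑ (suc n) g    ∎
  where open ≤-Reasoning

-- Only the first and the last element of a set escape the two-sided hypothesis.
∑-interior : ∀ n (p : ℕ → Bool) {κ} (g : ℕ → ℕ) →
  (∀ k → k < n → p k ≡ true → 1 ≤ κ) →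
  (∀ k₁ k k₂ → k₁ < k → k < k₂ → k₂ < n → p k₁ ≡ true → p k ≡ true → p k₂ ≡ true → 1 ≤ g k) →
  ∑ n (λ k → 𝟙 (p k)) ≤ 2 * κ + ∑ n g
∑-interior zero    p g one mid = z≤n
∑-interior (suc n) p {κ} g one mid with p n in pn
... | false = begin
  ∑ n (λ k → 𝟙 (p k)) + 0    ≡⟨ +-identityʳ _ ⟩
  ∑ n (λ k → 𝟙 (p k))
    ≤⟨ ∑-interior n p g (λ k k<n → one k (m<n⇒m<1+n k<n))
         (λ k₁ k k₂ l₁ l₂ l₃ → mid k₁ k k₂ l₁ l₂ (m<n⇒m<1+n l₃)) ⟩
  2 * κ + ∑ n g              ≤⟨ +-monoʳ-≤ (2 * κ) (m≤m+n _ _) ⟩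
  2 * κ + ∑ (suc n) g        ∎
  where open ≤-Reasoning
-- Here `n` is the last element. It serves as `k₂` for all the others, so only the first of them can
-- still lack a neighbour.
... | true = begin
  ∑ n (λ k → 𝟙 (p k)) + 1
    ≤⟨ +-mono-≤ (∑-non-first n p g (λ k k<n → one k (m<n⇒m<1+n k<n))
                   (λ k₁ k l₁ l₂ p₁ p₂ → mid k₁ k n l₁ l₂ ≤-refl p₁ p₂ pn))
                (one n ≤-refl pn) ⟩
  κ + ∑ n g + κ              ≡⟨ rearrange κ (∑ n g) ⟩
  2 * κ + ∑ n g              ≤⟨ +-monoʳ-≤ (2 * κ) (m≤m+n _ _) ⟩
  2 * κ + ∑ (suc n) g        ∎
  where
  open ≤-Reasoning
  rearrange : ∀ a b → a + b + a ≡ 2 * a + b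
  rearrange = solve-∀

-- Equality tests and positions in lists

true≢false : ∀ {b} {B : Set} → b ≡ true → b ≡ false → B
true≢false refl ()

≡ᵇ-sound : ∀ m n → (m ≡ᵇ n) ≡ true → m ≡ n
≡ᵇ-sound m n e = ≡ᵇ⇒≡ m n (subst T (sym e) _)

≡ᵇ-refl : ∀ n → (n ≡ᵇ n) ≡ true
≡ᵇ-refl zero    = refl
≡ᵇ-refl (suc n) = ≡ᵇ-refl n

∧-true : ∀ {a b} → a ∧ b ≡ true → a ≡ true × b ≡ true
∧-true {true} e = refl , e

==L-sound : ∀ l l' → (l ==L l') ≡ true → l ≡ l'
==L-sound (A i j) (A i' j') e =
  cong₂ A (≡ᵇ-sound i i' (proj₁ (∧-true e))) (≡ᵇ-sound j j' (proj₂ (∧-true {i ≡ᵇ i'} e)))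
==L-sound (tau j) (tau j')  e = cong tau (≡ᵇ-sound j j' e)
==L-sound norma2  norma2    e = refl
==L-sound norma   norma     e = refl

==L-refl : ∀ l → (l ==L l) ≡ true
==L-refl (A i j) rewrite ≡ᵇ-refl i = ≡ᵇ-refl j
==L-refl (tau j) = ≡ᵇ-refl j
==L-refl norma2  = refl
==L-refl norma   = refl

==N-sound : ∀ u v → (u ==N v) ≡ true → u ≡ v
==N-sound (inp l) (inp l') e = cong inp (==L-sound l l' e)
==N-sound (ins t) (ins t') e = cong ins (≡ᵇ-sound t t' e)

==N-refl : ∀ u → (u ==N u) ≡ true
==N-refl (inp l) = ==L-refl l
==N-refl (ins t) = ≡ᵇ-refl t

-- A relation in place of `nth`: no default element intervenes, and positions add up along `++`.
data At {X : Set} : List X → ℕ → X → Set where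
  here  : ∀ {x xs} → At (x ∷ xs) 0 x
  there : ∀ {x y xs n} → At xs n x → At (y ∷ xs) (suc n) x

module _ {X : Set} where

  At-functional : ∀ {xs : List X} {n x y} → At xs n x → At xs n y → x ≡ y
  At-functional here      here      = refl
  At-functional (there a) (there b) = At-functional a b

  At-< : ∀ {xs : List X} {n x} → At xs n x → n < length xs
  At-< here      = z<s
  At-< (there a) = s<s (At-< a)

  At-++ˡ : ∀ {xs ys : List X} {n x} → At xs n x → At (xs ++ ys) n x
  At-++ˡ here      = here
  At-++ˡ (there a) = there (At-++ˡ a)

  At-++ʳ : ∀ (xs : List X) {ys n x} → At ys n x → At (xs ++ ys) (length xs + n) x
  At-++ʳ []       a = a
  At-++ʳ (x ∷ xs) a = there (At-++ʳ xs a)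

  At-total : ∀ (xs : List X) {n} → n < length xs → ∃ (At xs n)
  At-total (x ∷ xs) {zero}  _       = x , here
  At-total (x ∷ xs) {suc n} (s≤s l) = let y , a = At-total xs l in y , there a

  At-All : ∀ {P : X → Set} {xs : List X} {n x} → All P xs → At xs n x → P x
  At-All (p ∷ ps) here      = p
  At-All (p ∷ ps) (there a) = At-All ps a

  At-nth : ∀ {xs : List X} {n x} d → At xs n x → nth d xs n ≡ x
  At-nth d here      = refl
  At-nth d (there a) = At-nth d a

  At-applyUpTo : ∀ (f : ℕ → X) {n k} → k < n → At (applyUpTo f n) k (f k)
  At-applyUpTo f {suc n} {zero}  _       = here
  At-applyUpTo f {suc n} {suc k} (s≤s l) = there (At-applyUpTo (f ∘ suc) l)

-- Position in a loop: total length of the earlier iterations plus the offset in the current one.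
-- The general `f` lets the induction shift it, and covers both the outer loop (`id`) and the column
-- loop (`suc k +_`).
At-concatMap : ∀ {X Y : Set} (F : X → List Y) (f : ℕ → X) {n k o y} → k < n → At (F (f k)) o y →
  At (concatMap F (applyUpTo f n)) (length (concatMap F (applyUpTo f k)) + o) y
At-concatMap F f {suc n} {zero}  _       a = At-++ˡ a
At-concatMap F f {suc n} {suc k} {o} {y} (s≤s l) a =
  subst (λ p → At (concatMap F (applyUpTo f (suc n))) p y) shift
    (At-++ʳ (F (f 0)) (At-concatMap F (f ∘ suc) l a))
  where
  rest : List _
  rest = concatMap F (applyUpTo (f ∘ suc) k)
  shift : length (F (f 0)) + (length rest + o) ≡ length (F (f 0) ++ rest) + o
  shift = trans (sym (+-assoc (length (F (f 0))) _ o)) (cong (_+ o) (sym (length-++ (F (f 0)))))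

-- Flow dependences

-- Specifies the node that `buildPreds` associates with `l` just before position `n` of `is`, where
-- `lw` is the state before `is` and instances are numbered from `t`.
data LastWriter (lw : Loc → Node) (t : ℕ) (is : List Instr) (n : ℕ) (l : Loc) : Node → Set where
  unwritten : (∀ {m ι} → m < n → At is m ι → write ι ≢ l) → LastWriter lw t is n l (lw l)
  written   : ∀ {m ι} → m < n → At is m ι → write ι ≡ l →
              (∀ {m' ι'} → m < m' → m' < n → At is m' ι' → write ι' ≢ l) →
              LastWriter lw t is n l (ins (t + m))

pred-lastWriter : ∀ {is n ι l} t lw → At is n ι → l ∈ reads ι →
  ∃ λ u → u ∈ nth [] (buildPreds t lw is) n × LastWriter lw t is n l u
pred-lastWriter t lw here l∈ = _ , ∈-map⁺ lw l∈ , unwritten λ ()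
pred-lastWriter {ι₀ ∷ is} {suc n} {ι} {l} t lw (there a) l∈
  with pred-lastWriter (suc t) (λ l → if l ==L write ι₀ then ins t else lw l) a l∈
... | _ , u∈ , written {m} m<n b w later =
  _ , u∈ , subst (LastWriter lw t (ι₀ ∷ is) (suc n) l) (cong ins (+-suc t m))
    (written (s<s m<n) (there b) w λ { (s≤s l₁) (s≤s l₂) (there a') → later l₁ l₂ a' })
-- No earlier instruction of the tail writes `l`, so the node comes from the updated map: it is the
-- head instance exactly when the head writes `l`.
... | u , u∈ , unwritten none with l ==L write ι₀ in eq
...   | true = _ , u∈ , subst (LastWriter lw t (ι₀ ∷ is) (suc n) l) (cong ins (+-identityʳ t))
    (written z<s here (sym (==L-sound l _ eq)) λ { _ (s≤s l₂) (there a') → none l₂ a' })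
...   | false = _ , u∈ , unwritten λ
    { {zero}  _        here      refl → true≢false (==L-refl l) eq
    ; {suc m} (s≤s l₁) (there b) → none l₁ b }

-- Under this condition a write to `l` continues the chain of versions of `l` instead of starting a
-- new one.
SelfRead : Loc → Instr → Set
SelfRead l ι = write ι ≡ l → l ∈ reads ι

-- Pebble games

set-hit : ∀ f v b → set f v b v ≡ b
set-hit f v b rewrite ==N-refl v = refl

set-true⁻ : ∀ f v u → set f v true u ≡ true → u ≡ v ⊎ f u ≡ true
set-true⁻ f v u e with u ==N v in eq
... | true  = inj₁ (==N-sound u v eq)
... | false = inj₂ e

set-true⁺ : ∀ f v u → f u ≡ true → set f v true u ≡ true
set-true⁺ f v u e with u ==N v
... | true  = refl
... | false = e

set-true-false : ∀ f v u → set f v true u ≡ false → f u ≡ false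
set-true-false f v u e with u ==N v
... | false = e

set-false⁻ : ∀ f v u → set f v false u ≡ true → f u ≡ true
set-false⁻ f v u e with u ==N v
... | false = e

loaded : List Move → List Node
loaded []               = []
loaded (spill v ∷ ms)   = loaded ms
loaded (compute v ∷ ms) = loaded ms
loaded (load v ∷ ms)    = v ∷ loaded ms

length-loaded : ∀ ms → length (loaded ms) ≡ loads ms
length-loaded []               = refl
length-loaded (spill v ∷ ms)   = length-loaded ms
length-loaded (compute v ∷ ms) = length-loaded ms
length-loaded (load v ∷ ms)    = cong suc (length-loaded ms)

module _ {M N : ℕ} where

  -- Invariant of the configurations reachable from `initial`. The field `white-closed` lets
  -- whiteness travel backwards along dependences.
  record Valid (c : Config) : Set where
    field
      red-vertex   : ∀ {u} → red c u ≡ true → u ∈ vertices M N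
      red-white    : ∀ {u} → red c u ≡ true → white c u ≡ true
      white-closed : ∀ {u v} → u ∈ preds M N v → white c v ≡ true → white c u ≡ true
      inputs-white : ∀ l → white c (inp l) ≡ true
  open Valid public

  valid-initial : Valid initial
  valid-initial .white-closed {v = inp l} () _
  valid-initial .white-closed {v = ins t} _ ()
  valid-initial .inputs-white l = refl

  valid-step : ∀ {c m c'} → Step M N c m c' → Valid c → Valid c'
  valid-step {c} (spill {v = x} x∈ _) V = record
    { red-vertex   = λ r → red-vertex V (set-false⁻ (red c) x _ r)
    ; red-white    = λ r → red-white V (set-false⁻ (red c) x _ r)
    ; white-closed = white-closed V
    ; inputs-white = inputs-white V }
  valid-step {c} (load {v = x} x∈ wx) V .red-vertex {u} r with set-true⁻ (red c) x u r
  ... | inj₁ refl = x∈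
  ... | inj₂ r'   = red-vertex V r'
  valid-step {c} (load {v = x} x∈ wx) V .red-white {u} r with set-true⁻ (red c) x u r
  ... | inj₁ refl = wx
  ... | inj₂ r'   = red-white V r'
  valid-step (load x∈ wx) V .white-closed = white-closed V
  valid-step (load x∈ wx) V .inputs-white = inputs-white V
  valid-step {c} (compute {v = x} x∈ _ reds) V .red-vertex {u} r with set-true⁻ (red c) x u r
  ... | inj₁ refl = x∈
  ... | inj₂ r'   = red-vertex V r'
  valid-step {c} (compute {v = x} x∈ _ reds) V .red-white {u} r with set-true⁻ (red c) x u r
  ... | inj₁ refl = set-hit (white c) x true
  ... | inj₂ r'   = set-true⁺ (white c) x u (red-white V r')
  valid-step {c} (compute {v = x} x∈ _ reds) V .white-closed {u} {v} u∈ w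
    with set-true⁻ (white c) x v w
  ... | inj₁ refl = set-true⁺ (white c) x u (red-white V (All.lookup reds u∈))
  ... | inj₂ w'   = set-true⁺ (white c) x u (white-closed V u∈ w')
  valid-step {c} (compute {v = x} x∈ _ reds) V .inputs-white l =
    set-true⁺ (white c) x (inp l) (inputs-white V l)

  white-mono-step : ∀ {c m c' u} → Step M N c m c' → white c u ≡ true → white c' u ≡ true
  white-mono-step {c} (compute {v = x} _ _ _) w = set-true⁺ (white c) x _ w
  white-mono-step (spill _ _) w = w
  white-mono-step (load _ _)  w = w

  module _ {S : ℕ} where

    valid-game : ∀ {c ms c'} → Game M N S c ms c' → Valid c → Valid c'
    valid-game done         V = V
    valid-game (step s _ g) V = valid-game g (valid-step s V)

    white-mono : ∀ {c ms c' u} → Game M N S c ms c' → white c u ≡ true → white c' u ≡ true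
    white-mono done         w = w
    white-mono (step s _ g) w = white-mono g (white-mono-step s w)

    -- When `v` is computed, `u` carries a red pebble. That pebble was there from the start, or was
    -- placed by a load, or was placed by computing `u` within the same moves.
    pred-origin : ∀ {c ms c' u v} → Game M N S c ms c' → u ∈ preds M N v →
      white c v ≡ false → white c' v ≡ true →
      (red c u ≡ true ⊎ u ∈ loaded ms) ⊎ (white c u ≡ false × white c' u ≡ true)
    pred-origin done u∈ w w' = true≢false w' w
    pred-origin {c} {u = u} (step (spill {v = x} _ _) _ g) u∈ w w'
      with pred-origin g u∈ w w'
    ... | inj₁ (inj₁ r) = inj₁ (inj₁ (set-false⁻ (red c) x u r))
    ... | inj₁ (inj₂ p) = inj₁ (inj₂ p)
    ... | inj₂ q        = inj₂ q
    pred-origin {c} {u = u} (step (load {v = x} _ _) _ g) u∈ w w'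
      with pred-origin g u∈ w w'
    ... | inj₁ (inj₂ p) = inj₁ (inj₂ (there p))
    ... | inj₂ q        = inj₂ q
    ... | inj₁ (inj₁ r) with set-true⁻ (red c) x u r
    ...   | inj₁ refl = inj₁ (inj₂ (here refl))
    ...   | inj₂ r'   = inj₁ (inj₁ r')
    pred-origin {c} {u = u} {v} (step (compute {v = x} _ wx reds) _ g) u∈ w w'
      with set (white c) x true v in eq
    -- This move makes `v` white, so it computes `v` itself and its predecessors are red right now.
    ... | true with set-true⁻ (white c) x v eq
    ...   | inj₁ refl = inj₁ (inj₁ (All.lookup reds u∈))
    ...   | inj₂ e    = true≢false e w
    pred-origin {c} {u = u} {v} (step (compute {v = x} _ wx reds) _ g) u∈ w w'
        | false with pred-origin g u∈ eq w'
    ... | inj₁ (inj₂ p)   = inj₁ (inj₂ p)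
    ... | inj₂ (e , e')   = inj₂ (set-true-false (white c) x u e , e')
    ... | inj₁ (inj₁ r) with set-true⁻ (red c) x u r
    ...   | inj₁ refl = inj₂ (wx , white-mono g (set-hit (white c) x true))
    ...   | inj₂ r'   = inj₁ (inj₁ r')

    redCount-game : ∀ {c ms c'} → Game M N S c ms c' → redCount M N c ≤ S → redCount M N c' ≤ S
    redCount-game done         r = r
    redCount-game (step _ r g) _ = redCount-game g r

    -- For positive `T` the cut falls immediately after the `T`-th load.
    split-game : ∀ {c ms c'} T → Game M N S c ms c' → T ≤ loads ms →
      ∃ λ d → ∃ λ ms₁ → ∃ λ ms₂ → Game M N S c ms₁ d × Game M N S d ms₂ c' ×
        loads ms₁ ≡ T × T + loads ms₂ ≡ loads ms
    split-game zero g _ = _ , _ , _ , done , g , refl , refl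
    split-game (suc T) (step s@(spill _ _) r g) T≤ =
      let d , ms₁ , ms₂ , g₁ , g₂ , e₁ , e₂ = split-game (suc T) g T≤
      in  d , _ , ms₂ , step s r g₁ , g₂ , e₁ , e₂
    split-game (suc T) (step s@(compute _ _ _) r g) T≤ =
      let d , ms₁ , ms₂ , g₁ , g₂ , e₁ , e₂ = split-game (suc T) g T≤
      in  d , _ , ms₂ , step s r g₁ , g₂ , e₁ , e₂
    split-game (suc T) (step s@(load _ _) r g) (s≤s T≤) =
      let d , ms₁ , ms₂ , g₁ , g₂ , e₁ , e₂ = split-game T g T≤
      in  d , _ , ms₂ , step s r g₁ , g₂ , cong suc e₁ , cong suc e₂

    -- At most `loads ms / T + 1` segments are cut off, each worth `F`. Multiplying by `T` avoids
    -- the division; the incomplete last segment produces the extra `T`. The number `n` bounds the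
    -- recursion.
    segment-bound : ∀ T F (value : Config → ℕ) → 0 < T →
      (∀ {c ms c'} → Game M N S c ms c' → Valid c → redCount M N c ≤ S → loads ms ≤ T →
         value c' ≤ value c + F) →
      ∀ n {c ms c'} → Game M N S c ms c' → Valid c → redCount M N c ≤ S → loads ms ≤ n →
      T * value c' ≤ T * value c + (loads ms + T) * F
    segment-bound T F value 0<T short n {c} {ms} {c'} g V R l≤n with ≤-total (loads ms) T
    ... | inj₁ l≤T = begin
      T * value c'                          ≤⟨ *-monoʳ-≤ T (short g V R l≤T) ⟩
      T * (value c + F)                     ≡⟨ *-distribˡ-+ T (value c) F ⟩
      T * value c + T * F                   ≤⟨ +-monoʳ-≤ _ (*-monoˡ-≤ F (m≤n+m T (loads ms))) ⟩
      T * value c + (loads ms + T) * F      ∎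
      where open ≤-Reasoning
    segment-bound T F value 0<T short zero g V R l≤n | inj₂ T≤l =
      ⊥-elim (<⇒≱ 0<T (≤-trans T≤l l≤n))
    segment-bound T F value 0<T short (suc n) {c} {ms} {c'} g V R l≤n | inj₂ T≤l
      with split-game T g T≤l
    ... | d , ms₁ , ms₂ , g₁ , g₂ , e₁ , e₂ = begin
      T * value c'
        ≤⟨ segment-bound T F value 0<T short n g₂ (valid-game g₁ V) (redCount-game g₁ R) l₂≤n ⟩
      T * value d + (loads ms₂ + T) * F
        ≤⟨ +-monoˡ-≤ _ (*-monoʳ-≤ T (short g₁ V R (≤-reflexive e₁))) ⟩
      T * (value c + F) + (loads ms₂ + T) * F      ≡⟨ regroup T (value c) F (loads ms₂) ⟩
      T * value c + (T + loads ms₂ + T) * F        ≡⟨ cong (λ l → T * value c + (l + T) * F) e₂ ⟩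
      T * value c + (loads ms + T) * F             ∎
      where
      open ≤-Reasoning
      regroup : ∀ T v F l → T * (v + F) + (l + T) * F ≡ T * v + (T + l + T) * F
      regroup = solve-∀
      l₂≤n : loads ms₂ ≤ n
      l₂≤n = s≤s⁻¹ (≤-trans (≤-trans (+-monoˡ-≤ (loads ms₂) 0<T) (≤-reflexive e₂)) l≤n)

-- The Householder program

At-map : ∀ {X Y : Set} (f : X → Y) {xs n x} → At xs n x → At (map f xs) n (f x)
At-map f here      = here
At-map f (there a) = there (At-map f a)

At-range : ∀ {a b i} → a ≤ i → i < b → At (range a b) (i ∸ a) i
At-range {a} {b} {i} a≤i i<b =
  subst (At (range a b) (i ∸ a)) (m+[n∸m]≡n a≤i)
    (At-map (a +_) (At-applyUpTo id (∸-monoˡ-< i<b a≤i)))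

-- The prefix is a witness instead of an explicit list, since `start` needs only its length.
SuffixOf : {X : Set} → List X → List X → Set
SuffixOf ys xs = ∃ λ pre → xs ≡ pre ++ ys

suffix-∷ : ∀ {X : Set} {x : X} {ys xs} → SuffixOf ys xs → SuffixOf ys (x ∷ xs)
suffix-∷ {x = x} (pre , e) = x ∷ pre , cong (x ∷_) e

suffix-++ : ∀ {X : Set} (zs : List X) {ys xs} → SuffixOf ys xs → SuffixOf ys (zs ++ xs)
suffix-++ zs {ys} (pre , e) = zs ++ pre , trans (cong (zs ++_) e) (sym (++-assoc zs pre ys))

reduceRow updateRow : ℕ → ℕ → ℕ → Instr
reduceRow k j i = tau j ← (tau j ∷ A i k ∷ A i j ∷ [])
updateRow k j i = A i j ← (A i j ∷ A i k ∷ tau j ∷ [])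

module _ (M N : ℕ) where

  columns : ℕ → ℕ → List Instr
  columns k n = concatMap (iterJ M N k) (range (suc k) n)

  iterK-columns : ∀ k → SuffixOf (columns k N) (iterK M N k)
  iterK-columns k =
    suffix-∷ (suffix-++ (map _ (range (suc k) M)) (suffix-∷ (suffix-∷ (suffix-∷
      (suffix-++ (map _ (range (suc k) M)) (suffix-∷ ([] , refl)))))))

  iterKs : ℕ → List Instr
  iterKs n = concatMap (iterK M N) (upTo n)

  -- Position in the trace of the first instruction of column `j` in step `k`.
  start : ℕ → ℕ → ℕ
  start k j = length (iterKs k) + (length (proj₁ (iterK-columns k)) + length (columns k j))

  At-iterK : ∀ {k n o ι} → k < n → At (iterK M N k) o ι → At (iterKs n) (length (iterKs k) + o) ι
  At-iterK = At-concatMap (iterK M N) id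

  At-columns : ∀ {k j n o ι} → k < j → j < n → At (iterJ M N k j) o ι →
    At (columns k n) (length (columns k j) + o) ι
  At-columns {k} {j} {n} {o} k<j j<n a
    rewrite map-upTo (suc k +_) (n ∸ suc k) | map-upTo (suc k +_) (j ∸ suc k) =
    At-concatMap (iterJ M N k) (suc k +_) (∸-monoˡ-< j<n k<j)
      (subst (λ j → At (iterJ M N k j) o _) (sym (m+[n∸m]≡n k<j)) a)

  At-iterJ : ∀ {k j n o ι} → k < n → k < j → j < N → At (iterJ M N k j) o ι →
    At (iterKs n) (start k j + o) ι
  At-iterJ {k} {j} {n} {o} {ι} k<n k<j j<N a =
    subst (λ p → At (iterKs n) p ι) shift
      (At-iterK k<n (subst (λ is → At is (length (proj₁ (iterK-columns k)) + (length (columns k j) + o)) ι)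
        (sym (proj₂ (iterK-columns k)))
        (At-++ʳ (proj₁ (iterK-columns k)) (At-columns k<j j<N a))))
    where
    shift : length (iterKs k) + (length (proj₁ (iterK-columns k)) + (length (columns k j) + o))
            ≡ start k j + o
    shift = trans (cong (length (iterKs k) +_) (sym (+-assoc (length (proj₁ (iterK-columns k))) _ o)))
                  (sym (+-assoc (length (iterKs k)) _ o))

  -- `iterJ` without its first instruction, the only one there that overwrites `tau j` without
  -- reading it.
  iterJ-tail : ℕ → ℕ → List Instr
  iterJ-tail k j =
    map (reduceRow k j) (range (suc k) M)
    ++ (tau j ← (tau k ∷ tau j ∷ []))
    ∷  (A k j ← (A k j ∷ tau j ∷ []))
    ∷  map (updateRow k j) (range (suc k) M)

  -- The outer `suc` skips the initial assignment to `tau j`; the inner `suc (suc _)` skips the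
  -- scaling of `tau j` and the update of row `k`. Rows are counted from `suc k`.
  updatePos reducePos : ℕ → ℕ → ℕ → ℕ
  reducePos k j i = start k j + suc (i ∸ suc k)
  updatePos k j i =
    start k j + suc (length (map (reduceRow k j) (range (suc k) M)) + suc (suc (i ∸ suc k)))

  module _ {k j i n : ℕ} (k<n : k < n) (k<j : k < j) (j<N : j < N) (k<i : k < i) (i<M : i < M) where

    reduce-in-row : At (map (reduceRow k j) (range (suc k) M)) (i ∸ suc k) (reduceRow k j i)
    reduce-in-row = At-map (reduceRow k j) (At-range k<i i<M)

    At-reduce : At (iterKs n) (reducePos k j i) (reduceRow k j i)
    At-reduce = At-iterJ k<n k<j j<N (there (At-++ˡ reduce-in-row))

    update-in-tail : At (iterJ-tail k j)
      (length (map (reduceRow k j) (range (suc k) M)) + suc (suc (i ∸ suc k))) (updateRow k j i)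
    update-in-tail = At-++ʳ (map (reduceRow k j) (range (suc k) M))
      (there (there (At-map (updateRow k j) (At-range k<i i<M))))

    At-update : At (iterKs n) (updatePos k j i) (updateRow k j i)
    At-update = At-iterJ k<n k<j j<N (there update-in-tail)

  -- Above the diagonal the witness is the initial assignment to `tau j` in step `i`, on it the
  -- computation of `norma`, below it the accumulation of `norma2` in step `j`.
  cell-read : ∀ {i j} → i < M → j < N → ∃ λ t → ∃ λ ι → At (program M N) t ι × A i j ∈ reads ι
  cell-read {i} {j} i<M j<N with <-cmp i j
  ... | tri< i<j _ _  = _ , _ , At-iterJ (<-trans i<j j<N) i<j j<N here , here refl
  ... | tri≈ _ refl _ =
    _ , _ , At-iterK j<N (there (At-++ʳ (map _ (range (suc j) M)) here)) , here refl
  ... | tri> _ _ j<i  =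
    _ , _ , At-iterK j<N (there (At-++ˡ (At-map _ (At-range j<i i<M)))) , there (here refl)

  tail-selfRead : ∀ k j → All (SelfRead (tau j)) (iterJ-tail k j)
  tail-selfRead k j =
    All.++⁺ (All.map⁺ (All.universal (λ _ _ → here refl) _))
      ((λ _ → there (here refl)) ∷ (λ ()) ∷ All.map⁺ (All.universal (λ _ ()) _))

  program-selfRead : ∀ a b → All (SelfRead (A a b)) (program M N)
  program-selfRead a b = All.concat⁺ (All.map⁺ (All.universal iterK-selfRead (upTo N)))
    where
    iterJ-selfRead : ∀ k j → All (SelfRead (A a b)) (iterJ M N k j)
    iterJ-selfRead k j =
      (λ ()) ∷ All.++⁺ (All.map⁺ (All.universal (λ _ ()) _))
      ((λ ()) ∷ (λ { refl → here refl }) ∷ All.map⁺ (All.universal (λ { _ refl → here refl }) _))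
    iterK-selfRead : ∀ k → All (SelfRead (A a b)) (iterK M N k)
    iterK-selfRead k =
      (λ ()) ∷ All.++⁺ (All.map⁺ (All.universal (λ _ ()) _))
      ((λ ()) ∷ (λ { refl → here refl }) ∷ (λ ()) ∷
      All.++⁺ (All.map⁺ (All.universal (λ { _ refl → here refl }) _))
      ((λ { refl → here refl }) ∷
      All.concat⁺ (All.map⁺ (All.universal (iterJ-selfRead k) (range (suc k) N)))))

  -- Propagation of whiteness along flow dependences

  White : Config → ℕ → Set
  White c t = white c (ins t) ≡ true

  -- The last writer of `l` before `t` is white by `white-closed`. Either it is `s`, or it lies
  -- after `s`, reads `l` itself, and the descent continues from it.
  flow : ∀ {c s σ l} → Valid {M} {N} c → At (program M N) s σ → write σ ≡ l →
    ∀ t {ι} → At (program M N) t ι → l ∈ reads ι → s < t →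
    (∀ {x ξ} → s < x → x < t → At (program M N) x ξ → SelfRead l ξ) →
    White c t → White c s
  flow {c} {s} {σ} {l} V at-s w = <-rec Goal trace
    where
    Goal : ℕ → Set
    Goal t = ∀ {ι} → At (program M N) t ι → l ∈ reads ι → s < t →
      (∀ {x ξ} → s < x → x < t → At (program M N) x ξ → SelfRead l ξ) → White c t → White c s
    trace : ∀ t → (∀ {t'} → t' < t → Goal t') → Goal t
    trace t rec at-t l∈ s<t between wt with pred-lastWriter 0 inp at-t l∈
    ... | _ , u∈ , unwritten none = ⊥-elim (none s<t at-s w)
    ... | _ , u∈ , written {x} x<t at-x wx later with <-cmp s x
    ...   | tri< s<x _ _  = rec x<t at-x (between s<x x<t at-x wx) s<x
                              (λ s<y y<x → between s<y (<-trans y<x x<t)) (white-closed V u∈ wt)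
    ...   | tri≈ _ refl _ = white-closed V u∈ wt
    ...   | tri> _ _ x<s  = ⊥-elim (later x<s s<t at-s w)

  -- The entry written by the update of row `i` at step `k` flows into the reduction of row `i` at
  -- step `k'`; the reduction flows through `tau j` into the update of every row `i'` at step `k'`.
  -- Hence the rows `i` and `i'` are independent: this is the neck of the hourglass.
  hop : ∀ {c k k' j i i'} → Valid {M} {N} c → k < k' → k' < j → j < N →
    k' < i → i < M → k' < i' → i' < M → White c (updatePos k' j i') → White c (updatePos k j i)
  hop {c} {k} {k'} {j} {i} {i'} V k<k' k'<j j<N k'<i i<M k'<i' i'<M w =
    flow V at-update refl (reducePos k' j i) at-reduce (there (there (here refl))) before
      (λ _ _ a → At-All (program-selfRead i j) a)
      (flow V at-reduce refl (updatePos k' j i')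
        (At-update k'<N k'<j j<N k'<i' i'<M) (there (there (here refl))) within tail-only w)
    where
    k'<N : k' < N
    k'<N = <-trans k'<j j<N
    k<j : k < j
    k<j = <-trans k<k' k'<j
    k<i : k < i
    k<i = <-trans k<k' k'<i
    at-update : At (program M N) (updatePos k j i) (updateRow k j i)
    at-update = At-update (<-trans k<k' k'<N) k<j j<N k<i i<M
    at-reduce : At (program M N) (reducePos k' j i) (reduceRow k' j i)
    at-reduce = At-reduce k'<N k'<j j<N k'<i i<M
    -- With `n = k'`, `At-update` places the update among the first `k'` outer iterations, whose
    -- total length is at most `start k' j`.
    before : updatePos k j i < reducePos k' j i
    before = <-≤-trans (At-< (At-update {n = k'} k<k' k<j j<N k<i i<M))
               (≤-trans (m≤m+n _ _) (m≤m+n _ _))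
    within : reducePos k' j i < updatePos k' j i'
    within = +-monoʳ-< (start k' j) (s<s (<-≤-trans
               (At-< (reduce-in-row k'<N k'<j j<N k'<i i<M)) (m≤m+n _ _)))
    tail-only : ∀ {x ξ} → reducePos k' j i < x → x < updatePos k' j i' →
      At (program M N) x ξ → SelfRead (tau j) ξ
    tail-only {x} {ξ} r<x x<u at-x =
      -- A position between the reduction and the update stays in the block `iterJ M N k' j`, past
      -- its first instruction; `o` is its offset in `iterJ-tail`.
      let o = x ∸ suc (start k' j)
          x≡ : start k' j + suc o ≡ x
          x≡ = trans (+-suc _ o) (m+[n∸m]≡n (≤-trans (m<m+n _ z<s) (<⇒≤ r<x)))
          o< : suc o < suc (length (map (reduceRow k' j) (range (suc k') M)) + suc (suc (i' ∸ suc k')))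
          o< = +-cancelˡ-< (start k' j) _ _ (subst (_< updatePos k' j i') (sym x≡) x<u)
          ζ , at-o = At-total (iterJ-tail k' j)
            (<-trans (s<s⁻¹ o<) (At-< (update-in-tail k'<N k'<j j<N k'<i' i'<M)))
          at-x' = subst (λ p → At (program M N) p ζ) x≡ (At-iterJ k'<N k'<j j<N (there at-o))
      in  subst (SelfRead (tau j)) (At-functional at-x' at-x) (At-All (tail-selfRead k' j) at-o)

  -- Held nodes and the entries they own

  owner : Node → Loc
  owner (inp l) = l
  -- Beyond the end of the trace the default writes `norma`, so such a node owns no entry of `A`.
  owner (ins t) = write (nth (norma ← []) (program M N) t)

  held : Config → List Move → List Node
  held c ms = filterᵇ (red c) (vertices M N) ++ loaded ms

  -- Every write to an entry of A also reads it, so the versions of an entry form a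
  -- path of the CDAG; following it backwards out of the segment reaches a held node.
  entry-held : ∀ {S c ms c' a b} → Game M N S c ms c' → Valid {M} {N} c →
    ∀ t {ι} → At (program M N) t ι → A a b ∈ reads ι →
    white c (ins t) ≡ false → white c' (ins t) ≡ true →
    ∃ λ u → u ∈ held c ms × owner u ≡ A a b
  entry-held {S} {c} {ms} {c'} {a} {b} g V = <-rec _ trace
    where
    Goal : ℕ → Set
    Goal t = ∀ {ι} → At (program M N) t ι → A a b ∈ reads ι →
      white c (ins t) ≡ false → white c' (ins t) ≡ true →
      ∃ λ u → u ∈ held c ms × owner u ≡ A a b
    stop : ∀ {u} → red c u ≡ true ⊎ u ∈ loaded ms → owner u ≡ A a b →
      ∃ λ u → u ∈ held c ms × owner u ≡ A a b
    stop (inj₁ r) o =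
      _ , ∈-++⁺ˡ (∈-filter⁺ (Bool.T? ∘ red c) (red-vertex V r) (subst T (sym r) _)) , o
    stop (inj₂ p) o = _ , ∈-++⁺ʳ (filterᵇ (red c) (vertices M N)) p , o
    trace : ∀ t → (∀ {t'} → t' < t → Goal t') → Goal t
    trace t rec at-t l∈ w w' with pred-lastWriter 0 inp at-t l∈
    ... | _ , u∈ , unwritten _ with pred-origin g u∈ w w'
    ...   | inj₁ h        = stop h refl
    ...   | inj₂ (e , _)  = true≢false (inputs-white V (A a b)) e
    trace t rec at-t l∈ w w' | _ , u∈ , written {x} x<t at-x wx _ with pred-origin g u∈ w w'
    ...   | inj₁ h        = stop h (trans (cong write (At-nth _ at-x)) wx)
    ...   | inj₂ (e , e') = rec x<t at-x (At-All (program-selfRead a b) at-x wx) e e'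

  owned : List Node → Loc → ℕ
  owned []       l = 0
  owned (u ∷ us) l = 𝟙 (owner u ==L l) + owned us l

  owned-∈ : ∀ {us u l} → u ∈ us → owner u ≡ l → 1 ≤ owned us l
  owned-∈ {u ∷ us} (here refl) refl rewrite ==L-refl (owner u) = s≤s z≤n
  owned-∈ {u ∷ us} (there p)   o    = ≤-trans (owned-∈ p o) (m≤n+m _ _)

  ∑-cell : ∀ m n l → ∑ n (λ j → ∑ m (λ i → 𝟙 (l ==L A i j))) ≤ 1
  ∑-cell m n (A a b) =
    ∑-single n b 1
      (λ j j≢b → trans (∑-cong m λ i _ → cong 𝟙 (trans (cong ((a ≡ᵇ i) ∧_) (off b j (j≢b ∘ sym)))
                                                      (Bool.∧-zeroʳ _))) (∑-zero m))
      (∑-single m a 1 (λ i i≢a → cong (λ x → 𝟙 (x ∧ (b ≡ᵇ b))) (off a i (i≢a ∘ sym))) (𝟙≤1 _))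
    where
    off : ∀ x y → x ≢ y → (x ≡ᵇ y) ≡ false
    off x y x≢y with x ≡ᵇ y in e
    ... | true  = ⊥-elim (x≢y (≡ᵇ-sound x y e))
    ... | false = refl
  ∑-cell m n (tau _) = ≤-trans (≤-reflexive (trans (∑-cong n λ _ _ → ∑-zero m) (∑-zero n))) z≤n
  ∑-cell m n norma2  = ≤-trans (≤-reflexive (trans (∑-cong n λ _ _ → ∑-zero m) (∑-zero n))) z≤n
  ∑-cell m n norma   = ≤-trans (≤-reflexive (trans (∑-cong n λ _ _ → ∑-zero m) (∑-zero n))) z≤n

  -- A node owns a single location, so it is counted for at most one entry.
  ∑-owned : ∀ m n us → ∑ n (λ j → ∑ m (λ i → owned us (A i j))) ≤ length us
  ∑-owned m n []       = ≤-reflexive (trans (∑-cong n λ _ _ → ∑-zero m) (∑-zero n))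
  ∑-owned m n (u ∷ us) = begin
    ∑ n (λ j → ∑ m (λ i → 𝟙 (owner u ==L A i j) + owned us (A i j)))
      ≡⟨ ∑-cong n (λ j _ → ∑-+ m _ _) ⟩
    ∑ n (λ j → ∑ m (λ i → 𝟙 (owner u ==L A i j)) + ∑ m (λ i → owned us (A i j)))
      ≡⟨ ∑-+ n _ _ ⟩
    ∑ n (λ j → ∑ m (λ i → 𝟙 (owner u ==L A i j))) + ∑ n (λ j → ∑ m (λ i → owned us (A i j)))
      ≤⟨ +-mono-≤ (∑-cell m n (owner u)) (∑-owned m n us) ⟩
    suc (length us) ∎
    where open ≤-Reasoning

-- Counting updates in a segment

<ᵇ-true : ∀ {m n} → m < n → (m <ᵇ n) ≡ true
<ᵇ-true l = Equivalence.to Bool.T-≡ (<⇒<ᵇ l)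

<ᵇ-sound : ∀ m n → (m <ᵇ n) ≡ true → m < n
<ᵇ-sound m n e = <ᵇ⇒< m n (subst T (sym e) _)

length-held : ∀ M N c ms → length (held M N c ms) ≡ redCount M N c + loads ms
length-held M N c ms =
  trans (length-++ (filterᵇ (red c) (vertices M N))) (cong (redCount M N c +_) (length-loaded ms))

redCount-initial : ∀ M N → redCount M N initial ≡ 0
redCount-initial M N =
  cong length (filter-none (Bool.T? ∘ red initial) (All.universal (λ _ ()) (vertices M N)))

module _ (N w : ℕ) where

  private
    M : ℕ
    M = N + w

  -- `updatePos` is the position of an actual update only for `k < j` and `k < i`, hence the two
  -- tests.
  updated : Config → ℕ → ℕ → ℕ → Bool
  updated c k j i = (k <ᵇ j) ∧ (k <ᵇ i) ∧ white c (ins (updatePos M N k j i))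

  updates : Config → ℕ
  updates c = ∑ N λ j → ∑ M λ i → ∑ N λ k → 𝟙 (updated c k j i)

  module Segment {S : ℕ} {c : Config} {ms : List Move} {c' : Config}
    (g : Game M N S c ms c') (V : Valid {M} {N} c) where

    fresh : ℕ → ℕ → ℕ → Bool
    fresh k j i = (k <ᵇ j) ∧ (k <ᵇ i) ∧
      not (white c (ins (updatePos M N k j i))) ∧ white c' (ins (updatePos M N k j i))

    updated≤ : ∀ k j i → 𝟙 (updated c' k j i) ≤ 𝟙 (updated c k j i) + 𝟙 (fresh k j i)
    updated≤ k j i with k <ᵇ j | k <ᵇ i | white c (ins (updatePos M N k j i))
    ... | false | _     | _     = z≤n
    ... | true  | false | _     = z≤n
    ... | true  | true  | true  = ≤-trans (𝟙≤1 _) (m≤m+n 1 _)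
    ... | true  | true  | false = ≤-refl

    record Fresh (k j i : ℕ) : Set where
      constructor mkFresh
      field
        k<j : k < j
        k<i : k < i
        old : white c (ins (updatePos M N k j i)) ≡ false
        new : white c' (ins (updatePos M N k j i)) ≡ true
    open Fresh

    toFresh : ∀ k j i → fresh k j i ≡ true → Fresh k j i
    toFresh k j i e =
      let a , e₁ = ∧-true {k <ᵇ j} e
          b , e₂ = ∧-true {k <ᵇ i} e₁
          o , n  = ∧-true {not (white c (ins (updatePos M N k j i)))} e₂
      in mkFresh (<ᵇ-sound k j a) (<ᵇ-sound k i b) (Bool.not-injective o) n

    κ : ℕ → ℕ → ℕ
    κ i j = owned M N (held M N c ms) (A i j)

    κ-target : ∀ {k j i} → j < N → i < M → Fresh k j i → 1 ≤ κ i j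
    κ-target j<N i<M f =
      let _ , u∈ , o = entry-held M N g V _
            (At-update M N (<-trans (k<j f) j<N) (k<j f) j<N (k<i f) i<M) (here refl) (old f) (new f)
      in owned-∈ M N u∈ o

    κ-pivot : ∀ {k j i} → j < N → i < M → Fresh k j i → 1 ≤ κ i k
    κ-pivot j<N i<M f =
      let _ , u∈ , o = entry-held M N g V _
            (At-update M N (<-trans (k<j f) j<N) (k<j f) j<N (k<i f) i<M)
            (there (here refl)) (old f) (new f)
      in owned-∈ M N u∈ o

    heavy : ℕ → ℕ
    heavy j = 𝟙 (w ≤ᵇ ∑ M λ i → κ i j)

    -- The `w` rows from `N` on contribute at least 1 each. They lie below the pivot row of every
    -- step.
    heavy-intro : ∀ j → (∀ i → N ≤ i → i < M → 1 ≤ κ i j) → heavy j ≡ 1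
    heavy-intro j h = cong 𝟙 (Equivalence.to Bool.T-≡ (≤⇒≤ᵇ
      (≤-trans (≤-reflexive (sym (*-identityʳ w))) (∑-above N w 1 (λ i → κ i j) h))))

    w*heavy≤ : ∀ j → w * heavy j ≤ ∑ M λ i → κ i j
    w*heavy≤ j with w ≤ᵇ (∑ M λ i → κ i j) in e
    ... | true  = ≤-trans (≤-reflexive (*-identityʳ w)) (≤ᵇ⇒≤ w _ (subst T (sym e) _))
    ... | false = ≤-trans (≤-reflexive (*-zeroʳ w)) z≤n

    heavyPair : ℕ → ℕ → ℕ
    heavyPair j k = 𝟙 (k <ᵇ j) * (heavy k * heavy j)

    -- The hourglass: every path between consecutive updates of a column passes through
    -- its whole reduction, so the last w rows of an interior step lie in the segment.
    interior : ∀ {j i k₁ k k₂} → j < N → k₁ < k → k < k₂ →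
      Fresh k₁ j i → Fresh k j i → Fresh k₂ j i → i < M → 1 ≤ heavyPair j k
    interior {j} {i} {k₁} {k} {k₂} j<N k₁<k k<k₂ f₁ f f₂ i<M =
      ≤-reflexive (sym
        (cong₂ (λ b d → 𝟙 b * d) (<ᵇ-true (k<j f))
          (cong₂ _*_ (heavy-intro k λ i' N≤i' i'<M → κ-pivot j<N i'<M (row i' N≤i' i'<M))
                     (heavy-intro j λ i' N≤i' i'<M → κ-target j<N i'<M (row i' N≤i' i'<M)))))
      where
      row : ∀ i' → N ≤ i' → i' < M → Fresh k j i'
      row i' N≤i' i'<M = mkFresh (k<j f) k<i' (Bool.¬-not was-white)
        (hop M N (valid-game g V) k<k₂ (k<j f₂) j<N k₂<i' i'<M (k<i f₂) i<M (new f₂))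
        where
        k₂<i' : k₂ < i'
        k₂<i' = <-≤-trans (<-trans (k<j f₂) j<N) N≤i'
        k<i' : k < i'
        k<i' = <-trans k<k₂ k₂<i'
        -- If row `i'` of step `k` were white at the start, `hop` would make the fresh update at
        -- `k₁` white at the start too.
        was-white : white c (ins (updatePos M N k j i')) ≢ true
        was-white e = true≢false (hop M N V k₁<k (k<j f) j<N (k<i f) i<M k<i' i'<M e) (old f₁)

    fresh≤ : ∀ j i → j < N → i < M →
      ∑ N (λ k → 𝟙 (fresh k j i)) ≤ 2 * κ i j + ∑ N (heavyPair j)
    fresh≤ j i j<N i<M = ∑-interior N (λ k → fresh k j i) (heavyPair j)
      (λ k _ e → κ-target j<N i<M (toFresh k j i e))
      (λ k₁ k k₂ k₁<k k<k₂ _ e₁ e e₂ →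
        interior j<N k₁<k k<k₂ (toFresh k₁ j i e₁) (toFresh k j i e) (toFresh k₂ j i e₂) i<M)

    totalκ : ℕ
    totalκ = ∑ N λ j → ∑ M λ i → κ i j

    pairs : ℕ
    pairs = ∑ N λ j → ∑ N (heavyPair j)

    totalFresh : ℕ
    totalFresh = ∑ N λ j → ∑ M λ i → ∑ N λ k → 𝟙 (fresh k j i)

    updates-step : updates c' ≤ updates c + totalFresh
    updates-step = begin
      updates c'
        ≤⟨ ∑-mono N (λ j _ → ∑-mono M λ i _ → ∑-mono N λ k _ → updated≤ k j i) ⟩
      ∑ N (λ j → ∑ M λ i → ∑ N λ k → 𝟙 (updated c k j i) + 𝟙 (fresh k j i))
        ≡⟨ ∑-cong N (λ j _ → ∑-cong M λ i _ → ∑-+ N _ _) ⟩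
      ∑ N (λ j → ∑ M λ i → ∑ N (λ k → 𝟙 (updated c k j i)) + ∑ N (λ k → 𝟙 (fresh k j i)))
        ≡⟨ ∑-cong N (λ j _ → ∑-+ M _ _) ⟩
      ∑ N (λ j → ∑ M (λ i → ∑ N λ k → 𝟙 (updated c k j i)) + ∑ M (λ i → ∑ N λ k → 𝟙 (fresh k j i)))
        ≡⟨ ∑-+ N _ _ ⟩
      updates c + totalFresh ∎
      where open ≤-Reasoning

    totalFresh≤ : totalFresh ≤ 2 * totalκ + M * pairs
    totalFresh≤ = begin
      totalFresh
        ≤⟨ ∑-mono N (λ j j<N → ∑-mono M λ i i<M → fresh≤ j i j<N i<M) ⟩
      ∑ N (λ j → ∑ M λ i → 2 * κ i j + ∑ N (heavyPair j))
        ≡⟨ ∑-cong N (λ j _ → trans (∑-+ M _ _)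
             (cong₂ _+_ (∑-*ˡ M 2 λ i → κ i j) (∑-const M _))) ⟩
      ∑ N (λ j → 2 * ∑ M (λ i → κ i j) + M * ∑ N (heavyPair j))
        ≡⟨ trans (∑-+ N _ _) (cong₂ _+_ (∑-*ˡ N 2 _) (∑-*ˡ N M _)) ⟩
      2 * totalκ + M * pairs ∎
      where open ≤-Reasoning

    -- `∑-pairs` bounds `2 * pairs` by the square of the number of heavy columns; the factor `w * w`
    -- turns it into the square of `w * ∑ N heavy`, which is at most `K`.
    fresh-bound : ∀ {K} → length (held M N c ms) ≤ K →
      2 * (w * w * totalFresh) ≤ 4 * (w * w * K) + M * (K * K)
    fresh-bound {K} held≤K = begin
      2 * (w * w * totalFresh)
        ≤⟨ *-monoʳ-≤ 2 (*-monoʳ-≤ (w * w) totalFresh≤) ⟩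
      2 * (w * w * (2 * totalκ + M * pairs))
        ≡⟨ expand w totalκ M pairs ⟩
      4 * (w * w * totalκ) + M * (w * w * (2 * pairs))
        ≤⟨ +-mono-≤ (*-monoʳ-≤ 4 (*-monoʳ-≤ (w * w) κ≤K))
             (*-monoʳ-≤ M (*-monoʳ-≤ (w * w) (∑-pairs N heavy))) ⟩
      4 * (w * w * K) + M * (w * w * (∑ N heavy * ∑ N heavy))
        ≡⟨ cong (λ x → 4 * (w * w * K) + M * x) (squares w (∑ N heavy)) ⟩
      4 * (w * w * K) + M * ((w * ∑ N heavy) * (w * ∑ N heavy))
        ≤⟨ +-monoʳ-≤ (4 * (w * w * K)) (*-monoʳ-≤ M (*-mono-≤ heavy≤K heavy≤K)) ⟩
      4 * (w * w * K) + M * (K * K) ∎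
      where
      open ≤-Reasoning
      κ≤K : totalκ ≤ K
      κ≤K = ≤-trans (∑-owned M N M N (held M N c ms)) held≤K
      heavy≤K : w * ∑ N heavy ≤ K
      heavy≤K = ≤-trans (≤-reflexive (sym (∑-*ˡ N w heavy)))
                  (≤-trans (∑-mono N λ j _ → w*heavy≤ j) κ≤K)
      expand : ∀ w t m p → 2 * (w * w * (2 * t + m * p)) ≡ 4 * (w * w * t) + m * (w * w * (2 * p))
      expand = solve-∀
      squares : ∀ a b → a * a * (b * b) ≡ (a * b) * (a * b)
      squares = solve-∀

  -- At most `S` red nodes plus `3 * S` loads give `K = 4S`, and then the right side of
  -- `fresh-bound` factors as `16 S (M S + w²)`.
  short-segment : ∀ {S c ms c'} → Game M N S c ms c' → Valid c → redCount M N c ≤ S →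
    loads ms ≤ 3 * S → w * w * updates c' ≤ w * w * updates c + 8 * (S * (M * S + w * w))
  short-segment {S} {c} {ms} {c'} g V R l≤ = begin
    w * w * updates c'
      ≤⟨ *-monoʳ-≤ (w * w) updates-step ⟩
    w * w * (updates c + totalFresh)
      ≡⟨ *-distribˡ-+ (w * w) (updates c) totalFresh ⟩
    w * w * updates c + w * w * totalFresh
      ≤⟨ +-monoʳ-≤ (w * w * updates c) (*-cancelˡ-≤ 2 (≤-trans (fresh-bound held≤)
           (≤-reflexive (collect S M w)))) ⟩
    w * w * updates c + 8 * (S * (M * S + w * w)) ∎
    where
    open ≤-Reasoning
    open Segment g V
    held≤ : length (held M N c ms) ≤ S + 3 * S
    held≤ = ≤-trans (≤-reflexive (length-held M N c ms)) (+-mono-≤ R l≤)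
    collect : ∀ S m w → 4 * (w * w * (S + 3 * S)) + m * ((S + 3 * S) * (S + 3 * S))
                        ≡ 2 * (8 * (S * (m * S + w * w)))
    collect = solve-∀

  -- Updates and loads in a complete game

  updates-initial : updates initial ≡ 0
  updates-initial =
    trans (∑-cong N λ j _ → trans (∑-cong M λ i _ →
      trans (∑-cong N λ k _ → cong 𝟙 (never (k <ᵇ j) (k <ᵇ i))) (∑-zero N)) (∑-zero M)) (∑-zero N)
    where
    never : ∀ a b → a ∧ b ∧ false ≡ false
    never a b = trans (cong (a ∧_) (Bool.∧-zeroʳ b)) (Bool.∧-zeroʳ a)

  instance-white : ∀ {c t ι} → Complete M N c → At (program M N) t ι → white c (ins t) ≡ true
  instance-white C a = C (∈-++⁺ʳ _ (∈-map⁺ ins (∈-upTo⁺ (At-< a))))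

  rows-below : ∀ k → k < M → M ≤ suc k + ∑ M (λ i → 𝟙 (k <ᵇ i))
  rows-below k k<M with m≤n⇒∃[o]m+o≡n k<M
  ... | r , e rewrite sym e = +-monoʳ-≤ (suc k) (≤-trans (≤-reflexive (sym (*-identityʳ r)))
    (∑-above (suc k) r 1 (λ i → 𝟙 (k <ᵇ i)) λ i k<i _ → ≤-reflexive (cong 𝟙 (sym (<ᵇ-true k<i)))))

  -- Step `k` has `M - 1 - k` rows below its pivot; summing over `k < j` gives
  -- `j M - j (j + 1) / 2`. Doubling and moving the negative term across keeps this in the naturals.
  column-updates : ∀ j → j ≤ N →
    2 * (j * M) ≤ 2 * ∑ j (λ k → ∑ M (λ i → 𝟙 (k <ᵇ i))) + j * suc j
  column-updates zero    _   = z≤n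
  column-updates (suc j) j<N = begin
    2 * (suc j * M)            ≡⟨ *-distribˡ-+ 2 M (j * M) ⟩
    2 * M + 2 * (j * M)
      ≤⟨ +-mono-≤ (*-monoʳ-≤ 2 (rows-below j (<-≤-trans j<N (m≤m+n N w))))
                  (column-updates j (<⇒≤ j<N)) ⟩
    2 * (suc j + rj) + (2 * s + j * suc j)      ≡⟨ collect j rj s ⟩
    2 * (s + rj) + suc j * suc (suc j) ∎
    where
    open ≤-Reasoning
    rj s : ℕ
    rj = ∑ M (λ i → 𝟙 (j <ᵇ i))
    s  = ∑ j (λ k → ∑ M (λ i → 𝟙 (k <ᵇ i)))
    collect : ∀ j r s → 2 * (suc j + r) + (2 * s + j * suc j) ≡ 2 * (s + r) + suc j * suc (suc j)
    collect = solve-∀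

  module _ {c : Config} (C : Complete M N c) where

    updates-in-column : ∀ j → j < N →
      2 * (j * M) ≤ 2 * ∑ M (λ i → ∑ N λ k → 𝟙 (updated c k j i)) + j * suc j
    updates-in-column j j<N = ≤-trans (column-updates j (<⇒≤ j<N))
      (+-monoˡ-≤ (j * suc j) (*-monoʳ-≤ 2 (begin
        ∑ j (λ k → ∑ M (λ i → 𝟙 (k <ᵇ i)))           ≡⟨ ∑-swap j M _ ⟩
        ∑ M (λ i → ∑ j λ k → 𝟙 (k <ᵇ i))
          ≤⟨ ∑-mono M (λ i i<M → ∑-mono j λ k k<j → 𝟙≤ (k <ᵇ i) λ k<i →
               ≤-reflexive (sym (cong 𝟙 (all-updated k<j i<M k<i)))) ⟩
        ∑ M (λ i → ∑ j λ k → 𝟙 (updated c k j i))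
          ≤⟨ ∑-mono M (λ i _ → ∑-prefix (λ k → 𝟙 (updated c k j i)) (<⇒≤ j<N)) ⟩
        ∑ M (λ i → ∑ N λ k → 𝟙 (updated c k j i))    ∎)))
      where
      open ≤-Reasoning
      all-updated : ∀ {k i} → k < j → i < M → (k <ᵇ i) ≡ true → updated c k j i ≡ true
      all-updated {k} {i} k<j i<M k<i rewrite k<i | <ᵇ-true k<j =
        instance-white {c} C (At-update M N (<-trans k<j j<N) k<j j<N (<ᵇ-sound k i k<i) i<M)

    -- Sums `updates-in-column` over the columns up to `n`, tripled because the sum of `j (j + 1)`
    -- is `n (n + 1) (n + 2) / 3`.
    updates-complete : ∀ n → suc n ≤ N →
      3 * (suc n * n * M) ≤
      6 * ∑ (suc n) (λ j → ∑ M λ i → ∑ N λ k → 𝟙 (updated c k j i)) + suc n * n * suc (suc n)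
    updates-complete zero    _   = z≤n
    updates-complete (suc n) l = begin
      3 * (suc (suc n) * suc n * M)                       ≡⟨ split n M ⟩
      3 * (suc n * n * M) + 3 * (2 * (suc n * M))
        ≤⟨ +-mono-≤ (updates-complete n (<⇒≤ l)) (*-monoʳ-≤ 3 (updates-in-column (suc n) l)) ⟩
      6 * s + suc n * n * suc (suc n) + 3 * (2 * t + suc n * suc (suc n))
        ≡⟨ collect n s t ⟩
      6 * (s + t) + suc (suc n) * suc n * suc (suc (suc n)) ∎
      where
      open ≤-Reasoning
      s t : ℕ
      s = ∑ (suc n) (λ j → ∑ M λ i → ∑ N λ k → 𝟙 (updated c k j i))
      t = ∑ M λ i → ∑ N λ k → 𝟙 (updated c k (suc n) i)
      split : ∀ n m → 3 * (suc (suc n) * suc n * m) ≡ 3 * (suc n * n * m) + 3 * (2 * (suc n * m))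
      split = solve-∀
      collect : ∀ n s t → 6 * s + suc n * n * suc (suc n) + 3 * (2 * t + suc n * suc (suc n))
                          ≡ 6 * (s + t) + suc (suc n) * suc n * suc (suc (suc n))
      collect = solve-∀

  -- The whole game is taken as one segment. It starts without red pebbles, so held nodes are loads,
  -- and each entry of `A` is read by some instance computed in it.
  entries≤loads : ∀ {S ms c} → Game M N S initial ms c → Complete M N c → N * M ≤ loads ms
  entries≤loads {S} {ms} {c} g C = begin
    N * M                                                       ≡⟨ cong (N *_) (*-identityʳ M) ⟨
    N * (M * 1)                                                 ≡⟨ ∑-const N (M * 1) ⟨
    ∑ N (λ _ → M * 1)                                           ≡⟨ ∑-cong N (λ _ _ → ∑-const M 1) ⟨
    ∑ N (λ _ → ∑ M (λ _ → 1))
      ≤⟨ ∑-mono N (λ j j<N → ∑-mono M λ i i<M → owned-entry i<M j<N) ⟩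
    ∑ N (λ j → ∑ M (λ i → owned M N (held M N initial ms) (A i j)))
      ≤⟨ ∑-owned M N M N (held M N initial ms) ⟩
    length (held M N initial ms)                                ≡⟨ length-held M N initial ms ⟩
    redCount M N initial + loads ms
      ≡⟨ cong (_+ loads ms) (redCount-initial M N) ⟩
    loads ms                                                    ∎
    where
    open ≤-Reasoning
    owned-entry : ∀ {i j} → i < M → j < N → 1 ≤ owned M N (held M N initial ms) (A i j)
    owned-entry i<M j<N =
      let t , ι , a , r = cell-read M N i<M j<N
          _ , u∈ , o = entry-held M N g valid-initial t a r refl (instance-white {c} C a)
      in owned-∈ M N u∈ o

  -- Segments of `3 * S` loads, starting with no update computed; the common factor `S` is
  -- cancelled.
  3w²updates≤ : ∀ {S ms c} → 0 < S → Game M N S initial ms c →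
    3 * (w * w * updates c) ≤ 8 * ((loads ms + 3 * S) * (M * S + w * w))
  3w²updates≤ {S@(suc _)} {ms} {c} 0<S g = *-cancelˡ-≤ S (begin
    S * (3 * (w * w * updates c))                     ≡⟨ swap S (w * w * updates c) ⟩
    3 * S * (w * w * updates c)
      ≤⟨ segment-bound (3 * S) (8 * (S * (M * S + w * w))) (λ c → w * w * updates c) z<s
           (λ g → short-segment g) (loads ms) g valid-initial
           (≤-trans (≤-reflexive (redCount-initial M N)) z≤n) ≤-refl ⟩
    3 * S * (w * w * updates initial) + (loads ms + 3 * S) * (8 * (S * (M * S + w * w)))
      ≡⟨ cong (_+ (loads ms + 3 * S) * (8 * (S * (M * S + w * w))))
           (trans (cong (λ x → 3 * S * (w * w * x)) updates-initial) (vanish S w)) ⟩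
    (loads ms + 3 * S) * (8 * (S * (M * S + w * w)))  ≡⟨ pull (loads ms + 3 * S) S (M * S + w * w) ⟩
    S * (8 * ((loads ms + 3 * S) * (M * S + w * w)))  ∎)
    where
    open ≤-Reasoning
    swap : ∀ s x → s * (3 * x) ≡ 3 * s * x
    swap = solve-∀
    vanish : ∀ s x → 3 * s * (x * x * 0) ≡ 0
    vanish = solve-∀
    pull : ∀ l s d → l * (8 * (s * d)) ≡ s * (8 * (l * d))
    pull = solve-∀

-- Arithmetic of the final bound

module _ (n w S D L μ : ℕ) where

  private
    N M a : ℕ
    N = 8 + n
    M = N + w
    a = 3 * w + 2 * N

  -- Here `a` is `3M - N`. The first two hypotheses bound the contribution of `3 * S` by
  -- `3 * n * (a * N * (w * w))`. This amount is added to both sides, fits into the slack of the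
  -- update count, and is cancelled at the end.
  large-bound :
    8 * S ≤ n * M → 24 * M * D ≤ a * N * (w * w) →
    3 * (N * (7 + n) * M) ≤ 6 * μ + N * (7 + n) * suc N →
    3 * (w * w * μ) ≤ 8 * ((L + 3 * S) * D) →
    a * (N * N) * (w * w) ≤ 24 * D * L
  large-bound S≤ MD≤ μ≥ μ≤ = *-cancelˡ-≤ 8 (+-cancelʳ-≤ (3 * n * (a * N * (w * w))) _ _ (begin
    8 * (a * (N * N) * (w * w)) + 3 * n * (a * N * (w * w))
      -- The added polynomial is the exact difference of the sides in `slack`; all its coefficients
      -- are nonnegative.
      ≤⟨ m≤m+n _ (N * (w * w) * (2 * (n * n) + 44 * n + 236 + 60 * w + 3 * (w * n))) ⟩
    8 * (a * (N * N) * (w * w)) + 3 * n * (a * N * (w * w))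
      + N * (w * w) * (2 * (n * n) + 44 * n + 236 + 60 * w + 3 * (w * n))
      ≡⟨ slack n w ⟩
    12 * (w * w) * (N * (7 + n) * (2 * n + 15 + 3 * w))
      ≤⟨ *-monoʳ-≤ (12 * (w * w)) count ⟩
    12 * (w * w) * (6 * μ)                ≡⟨ scale (w * w) μ ⟩
    24 * (3 * (w * w * μ))                ≤⟨ *-monoʳ-≤ 24 μ≤ ⟩
    24 * (8 * ((L + 3 * S) * D))          ≡⟨ spread L S D ⟩
    8 * (24 * D * L) + 72 * D * (8 * S)   ≤⟨ +-monoʳ-≤ (8 * (24 * D * L)) (*-monoʳ-≤ (72 * D) S≤) ⟩
    8 * (24 * D * L) + 72 * D * (n * M)   ≡⟨ cong (8 * (24 * D * L) +_) (regroup D n M) ⟩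
    8 * (24 * D * L) + 3 * n * (24 * M * D)
      ≤⟨ +-monoʳ-≤ (8 * (24 * D * L)) (*-monoʳ-≤ (3 * n) MD≤) ⟩
    8 * (24 * D * L) + 3 * n * (a * N * (w * w)) ∎))
    where
    open ≤-Reasoning
    slack : ∀ n w →
      8 * ((3 * w + 2 * (8 + n)) * ((8 + n) * (8 + n)) * (w * w))
        + 3 * n * ((3 * w + 2 * (8 + n)) * (8 + n) * (w * w))
        + (8 + n) * (w * w) * (2 * (n * n) + 44 * n + 236 + 60 * w + 3 * (w * n))
      ≡ 12 * (w * w) * ((8 + n) * (7 + n) * (2 * n + 15 + 3 * w))
    slack = solve-∀
    -- The factor `2 * n + 15 + 3 * w` is `3M - N - 1`.
    count : N * (7 + n) * (2 * n + 15 + 3 * w) ≤ 6 * μ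
    count = +-cancelʳ-≤ (N * (7 + n) * suc N) _ _ (≤-trans (≤-reflexive (expand n w)) μ≥)
      where
      expand : ∀ n w → (8 + n) * (7 + n) * (2 * n + 15 + 3 * w) + (8 + n) * (7 + n) * (9 + n)
                       ≡ 3 * ((8 + n) * (7 + n) * (8 + n + w))
      expand = solve-∀
    scale : ∀ x m → 12 * x * (6 * m) ≡ 24 * (3 * (x * m))
    scale = solve-∀
    spread : ∀ l s d → 24 * (8 * ((l + 3 * s) * d)) ≡ 8 * (24 * d * l) + 72 * d * (8 * s)
    spread = solve-∀
    regroup : ∀ d n m → 72 * d * (n * m) ≡ 3 * n * (24 * m * d)
    regroup = solve-∀

-- If 24 M D ≥ a N w², the bound already follows from loading every entry of A;
-- otherwise N > 8 and S is at most (N - 8) M / 8.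
combine : ∀ N w S L μ → 0 < w → N * (N + w) ≤ L →
  (∀ n → N ≡ suc n → 3 * (suc n * n * (N + w)) ≤ 6 * μ + suc n * n * suc (suc n)) →
  3 * (w * w * μ) ≤ 8 * ((L + 3 * S) * ((N + w) * S + w * w)) →
  (3 * w + 2 * N) * (N * N) * (w * w) ≤ 24 * ((N + w) * S + w * w) * L
combine N w@(suc _) S L μ 0<w NM≤L μ≥ μ≤
  with <-≤-connex (24 * (N + w) * ((N + w) * S + w * w)) ((3 * w + 2 * N) * N * (w * w))
... | inj₂ small = begin
  a * (N * N) * (w * w)      ≡⟨ regroup a N (w * w) ⟩
  N * (a * N * (w * w))      ≤⟨ *-monoʳ-≤ N small ⟩
  N * (24 * M * D)           ≡⟨ regroup' N M D ⟩
  24 * D * (N * M)           ≤⟨ *-monoʳ-≤ (24 * D) NM≤L ⟩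
  24 * D * L                 ∎
  where
  open ≤-Reasoning
  M D a : ℕ
  M = N + w
  D = M * S + w * w
  a = 3 * w + 2 * N
  regroup : ∀ a n x → a * (n * n) * x ≡ n * (a * n * x)
  regroup = solve-∀
  regroup' : ∀ n m d → n * (24 * m * d) ≡ 24 * d * (n * m)
  regroup' = solve-∀
... | inj₁ large = conclude (m≤n⇒∃[o]m+o≡n (<⇒≤ 8<N))
  where
  open ≤-Reasoning
  M D a : ℕ
  M = N + w
  D = M * S + w * w
  a = 3 * w + 2 * N
  instance
    M≢0 : NonZero M
    M≢0 = >-nonZero (≤-trans 0<w (m≤n+m w N))
    3M≢0 : NonZero (3 * M)
    3M≢0 = m*n≢0 3 M
  -- Since `a + N = 3M`, replacing `a` by `3M` in `large` allows `3M` to be cancelled.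
  8D<Nw² : 8 * D < N * (w * w)
  8D<Nw² = *-cancelˡ-< (3 * M) _ _ (begin-strict
    3 * M * (8 * D)            ≡⟨ regroup M D ⟩
    24 * M * D                 <⟨ large ⟩
    a * N * (w * w)
      ≤⟨ *-monoˡ-≤ (w * w) (*-monoˡ-≤ N (≤-trans (m≤m+n a N) (≤-reflexive (fill N w)))) ⟩
    3 * M * N * (w * w)        ≡⟨ *-assoc (3 * M) N (w * w) ⟩
    3 * M * (N * (w * w))      ∎)
    where
    regroup : ∀ m d → 3 * m * (8 * d) ≡ 24 * m * d
    regroup = solve-∀
    fill : ∀ n w → 3 * w + 2 * n + n ≡ 3 * (n + w)
    fill = solve-∀
  8<N : 8 < N
  8<N = *-cancelʳ-< (w * w) 8 N (≤-<-trans (*-monoʳ-≤ 8 (m≤n+m (w * w) (M * S))) 8D<Nw²)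
  conclude : (∃ λ n → 8 + n ≡ N) → a * (N * N) * (w * w) ≤ 24 * D * L
  conclude (n , refl) =
    large-bound n w S D L μ 8S≤nM (<⇒≤ large) (μ≥ (7 + n) refl) μ≤
    where
    -- Removing `8 w²` from `8 D ≤ N w²` leaves `8 M S ≤ n w²`, and `w ≤ M`.
    8S≤nM : 8 * S ≤ n * M
    8S≤nM = *-cancelˡ-≤ M (+-cancelʳ-≤ (8 * (w * w)) _ _ (begin
      M * (8 * S) + 8 * (w * w)        ≡⟨ regroup M S (w * w) ⟩
      8 * D                            ≤⟨ <⇒≤ 8D<Nw² ⟩
      (8 + n) * (w * w)                ≡⟨ regroup' n (w * w) ⟩
      n * (w * w) + 8 * (w * w)        ≤⟨ +-monoˡ-≤ (8 * (w * w)) (*-monoʳ-≤ n (*-mono-≤ w≤M w≤M)) ⟩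
      n * (M * M) + 8 * (w * w)        ≡⟨ cong (_+ 8 * (w * w)) (regroup'' n M) ⟩
      M * (n * M) + 8 * (w * w)        ∎))
      where
      w≤M : w ≤ M
      w≤M = m≤n+m w N
      regroup : ∀ m s x → m * (8 * s) + 8 * x ≡ 8 * (m * s + x)
      regroup = solve-∀
      regroup' : ∀ n x → (8 + n) * x ≡ n * x + 8 * x
      regroup' = solve-∀
      regroup'' : ∀ n m → n * (m * m) ≡ m * (n * m)
      regroup'' = solve-∀

3[m+n]∸m : ∀ m n → 3 * (m + n) ∸ m ≡ 3 * n + 2 * m
3[m+n]∸m m n = trans (cong (_∸ m) (expand m n)) (m+n∸m≡n m _)
  where
  expand : ∀ m n → 3 * (m + n) ≡ m + (3 * n + 2 * m)
  expand = solve-∀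

theorem4 : (M N S : ℕ) → 0 < N → 0 < S → N < M →
    (ms : List Move) (c : Config) → Game M N S initial ms c → Complete M N c →
    (3 * M ∸ N) * (N * N) * ((M ∸ N) * (M ∸ N))
    ≤ 24 * (M * S + (M ∸ N) * (M ∸ N)) * loads ms
theorem4 M N S 0<N 0<S N<M ms c g C with m≤n⇒∃[o]m+o≡n (<⇒≤ N<M)
-- Writing `M = N + w` eliminates the truncated subtractions from the goal.
... | w , refl rewrite m+n∸m≡n N w | 3[m+n]∸m N w =
  combine N w S (loads ms) (updates N w c) 0<w (entries≤loads N w g C)
    (λ { n refl → updates-complete N w {c} C n ≤-refl }) (3w²updates≤ N w 0<S g)
  where
  0<w : 0 < w
  0<w = +-cancelˡ-< N 0 w (subst (_< N + w) (sym (+-identityʳ N)) N<M)
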